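{- Let $G$ be a nontrivial finite group of order $n$ that is not a cyclic group of prime power order. Then $\lambda(\Gamma_G)\le 2n-4$, with equality if and only if $G$ is isomorphic to $\mathbb{Z}_2\times\mathbb{Z}_2$ or to $\mathbb{Z}_{2q}$ for some odd prime $q$.
   Context: The (undirected) power graph $\Gamma_G$ of a finite group $G$ has vertex set $G$, two distinct elements being adjacent if one is a power of the other. $\mathbb{Z}_m$ denotes the cyclic group of order $m$. An $L(2,1)$-labeling of a graph $\Gamma$ is a function $f:V(\Gamma)\to\mathbb{Z}_{\ge 0}$ such that $|f(u)-f(v)|\ge 2$ for adjacent $u,v$ and $|f(u)-f(v)|\ge 1$ for $u,v$ at distance two; its span is $\max f-\min f$, and $\lambda(\Gamma)$ is the minimum span over all $L(2,1)$-labelings of $\Gamma$. -}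

module Defs where

open import Data.Nat using (ℕ; zero; suc; _+_; _*_; _∸_; _≤_; _⊔_; _⊓_)
open import Data.Nat.DivMod using (_mod_)
open import Data.Nat.Primality using (Prime)
open import Data.Fin using (Fin; toℕ)
open import Data.List using (List; foldr; map; allFin)
open import Data.Product using (Σ; ∃; ∃-syntax; _×_; _,_)
open import Data.Sum using (_⊎_)
open import Relation.Binary.PropositionalEquality using (_≡_; _≢_)
open import Relation.Nullary using (¬_)
open import Algebra.Core using (Op₁; Op₂)
open import Algebra.Structures using (IsGroup)

-- A finite group of order n, presented on the carrier Fin n
-- (every finite group of order n is isomorphic to such a one).
record FinGroup (n : ℕ) : Set where
  field
    _∙_     : Op₂ (Fin n)
    ε       : Fin n
    _⁻¹     : Op₁ (Fin n)
    isGroup : IsGroup _≡_ _∙_ ε _⁻¹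

module _ {n : ℕ} (G : FinGroup n) where
  open FinGroup G

  pow : Fin n → ℕ → Fin n
  pow x zero    = ε
  pow x (suc k) = x ∙ pow x k

  IsCyclic : Set
  IsCyclic = ∃[ g ] ((x : Fin n) → ∃[ k ] x ≡ pow g k)

  Adj : Fin n → Fin n → Set
  Adj u v = u ≢ v × ((∃[ k ] v ≡ pow u k) ⊎ (∃[ k ] u ≡ pow v k))

  Dist2 : Fin n → Fin n → Set
  Dist2 u v = u ≢ v × ¬ Adj u v × (∃[ w ] (Adj u w × Adj w v))

  IsL21 : (Fin n → ℕ) → Set
  IsL21 f = ((u v : Fin n) → Adj u v → 2 + f u ≤ f v ⊎ 2 + f v ≤ f u)
          × ((u v : Fin n) → Dist2 u v → f u ≢ f v)

  maxL : (Fin n → ℕ) → ℕ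
  maxL f = foldr _⊔_ 0 (map f (allFin n))

  -- minimum label (max f is added as a seed; harmless since n ≥ 1 here)
  minL : (Fin n → ℕ) → ℕ
  minL f = foldr _⊓_ (maxL f) (map f (allFin n))

  span : (Fin n → ℕ) → ℕ
  span f = maxL f ∸ minL f

  LambdaIs : ℕ → Set
  LambdaIs m = (∃[ f ] (IsL21 f × span f ≡ m))
             × ((f : Fin n → ℕ) → IsL21 f → m ≤ span f)

  IsoTo : (A : Set) → Op₂ A → Set
  IsoTo A _⊕_ = Σ (Fin n → A) λ φ → Σ (A → Fin n) λ ψ →
      (((x : Fin n) → ψ (φ x) ≡ x) × ((a : A) → φ (ψ a) ≡ a)
      × ((x y : Fin n) → φ (x ∙ y) ≡ φ x ⊕ φ y))

zadd : {m : ℕ} → Op₂ (Fin m)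
zadd {suc k} a b = (toℕ a + toℕ b) mod (suc k)

klein : Op₂ (Fin 2 × Fin 2)
klein (a , b) (c , d) = zadd a c , zadd b d

IsPrimePower : ℕ → Set
IsPrimePower n = ∃[ p ] ∃[ k ] (Prime p × n ≡ p Data.Nat.^ k)

{-# OPTIONS --safe #-}

-- The identity is adjacent to every other element, so an L(2,1)-labeling is an injective
-- labeling with gaps at least 2 along edges; labeling consecutively along a path with l vertices
-- in the complement of the power graph gives span at most 2n - (l + 1).
-- Two incomparable elements x, y that are not involutions give the path x, y, x⁻¹, y⁻¹ with l = 4,
-- and two involutions give such a path as soon as G is larger than the Klein group, because a
-- cyclic group contains at most one involution. Otherwise the elements that are not involutions
-- form a chain under "is a power of", whose greatest element generates G. In a cyclic group whose
-- order is not a prime power, incomparable elements that are not involutions are missing only for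
-- order 2q.
-- Conversely the power graph of ℤ₂q minus its involution is complete, which forces span 2n - 4.
module Submission where

open import Defs
open import Algebra.Bundles using (Group)
import Algebra.Properties.Group as GroupProperties
open import Algebra.Structures using (IsGroup)
open import Data.Empty using (⊥; ⊥-elim)
open import Data.Fin as Fin using (Fin; zero; suc; toℕ; fromℕ<; punchIn)
open import Data.Fin.Permutation using (↔⇒≡)
open import Data.Fin.Properties as Fin using (toℕ<n; toℕ-injective; toℕ-fromℕ<; fromℕ<-injective; injective⇒≤; any?; punchIn-injective; punchInᵢ≢i; pigeonhole; nonZeroIndex; fromℕ<-toℕ)
open import Data.List using ([]; _∷_; foldr; map; allFin)
open import Data.List.Membership.Propositional using (_∈_)
open import Data.List.Membership.Propositional.Properties using (∈-allFin; ∈-map⁺)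
open import Data.List.Relation.Unary.Any using (here; there)
open import Data.Nat
open import Data.Nat.Coprimality using (Coprime; coprime-Bézout)
open import Data.Nat.DivMod
open import Data.Nat.Divisibility
open import Data.Nat.GCD using (module Bézout)
open import Data.Nat.Induction using (<-rec)
open import Data.Nat.Primality
open import Data.Nat.Properties
open import Data.Nat.Tactic.RingSolver using (solve-∀)
open import Data.Product using (Σ; ∃-syntax; _×_; _,_; proj₁; proj₂)
open import Data.Sum using (_⊎_; inj₁; inj₂; [_,_]′)
open import Data.Vec as Vec using (Vec; []; _∷_)
open import Data.Vec.Relation.Unary.All using ([]; _∷_)
open import Data.Vec.Relation.Unary.AllPairs using ([]; _∷_)
open import Data.Vec.Relation.Unary.Linked using (Linked; []; [-]; _∷_)
open import Data.Vec.Relation.Unary.Unique.Propositional using (Unique)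
open import Data.Vec.Relation.Unary.Unique.Propositional.Properties using (lookup-injective)
open import Function.Base using (_∘_)
open import Function.Bundles using (_⇔_; mk⇔; mk↔ₛ′)
open import Function.Definitions using (Injective)
open import Function.Properties.Inverse using (↔-sym; ↔-trans)
open import Relation.Binary.Definitions using (tri<; tri≈; tri>)
open import Relation.Binary.PropositionalEquality
open import Relation.Nullary using (¬_; Dec; yes; no; contradiction; ¬?; _×-dec_; _⊎-dec_)
open import Relation.Nullary.Decidable using (map′)

-- Labelings and spans

foldr-⊔-≤ : ∀ {A : Set} (f : A → ℕ) {b} → (∀ x → f x ≤ b) → ∀ xs → foldr _⊔_ 0 (map f xs) ≤ b
foldr-⊔-≤ f f≤b []       = z≤n
foldr-⊔-≤ f f≤b (x ∷ xs) = ⊔-lub (f≤b x) (foldr-⊔-≤ f f≤b xs)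

∈⇒≤foldr-⊔ : ∀ {x b xs} → x ∈ xs → x ≤ foldr _⊔_ b xs
∈⇒≤foldr-⊔ (here refl) = m≤m⊔n _ _
∈⇒≤foldr-⊔ (there x∈) = ≤-trans (∈⇒≤foldr-⊔ x∈) (m≤n⊔m _ _)

∈⇒foldr-⊓≤ : ∀ {x b xs} → x ∈ xs → foldr _⊓_ b xs ≤ x
∈⇒foldr-⊓≤ (here refl) = m⊓n≤m _ _
∈⇒foldr-⊓≤ (there x∈) = ≤-trans (m⊓n≤n _ _) (∈⇒foldr-⊓≤ x∈)

Apart : ℕ → ℕ → Set
Apart a b = 2 + a ≤ b ⊎ 2 + b ≤ a

Apart⇒≢ : ∀ {a b} → Apart a b → a ≢ b
Apart⇒≢ (inj₁ h) refl = contradiction h (<⇒≱ (m<n⇒m<1+n ≤-refl))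
Apart⇒≢ (inj₂ h) refl = contradiction h (<⇒≱ (m<n⇒m<1+n ≤-refl))

-- This numbers the vertices off the path by 0, ..., n - l - 1. The map is total on `Fin n`, and its
-- values on path vertices carry no meaning. The induction removes the path vertices one at a time
-- and closes each gap with the element of largest index.
enumerate-complement : ∀ {n} l (p : Fin l → Fin n) → Injective _≡_ _≡_ p →
  Σ (Fin n → ℕ) λ r →
    (∀ v → (∀ i → p i ≢ v) → r v + l < n) ×
    (∀ u v → (∀ i → p i ≢ u) → (∀ i → p i ≢ v) → r u ≡ r v → u ≡ v)
enumerate-complement {n} zero p p-inj =
  toℕ , (λ v _ → subst (_< n) (sym (+-identityʳ _)) (toℕ<n v)) , (λ _ _ _ _ → toℕ-injective)
enumerate-complement {n} (suc l) p p-inj = r , r-bound , r-inj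
  where
  rec = enumerate-complement l (p ∘ suc) (Fin.suc-injective ∘ p-inj)
  r′ = proj₁ rec

  -- p zero leaves the enumeration, so its index is handed to the top element.
  r : Fin n → ℕ
  r v with suc (r′ v + l) ≟ n
  ... | yes _ = r′ (p zero)
  ... | no  _ = r′ v

  off₀ : ∀ i → p (suc i) ≢ p zero
  off₀ i eq with () ← p-inj eq

  ≢top : ∀ v → (∀ i → p (suc i) ≢ v) → suc (r′ v + l) ≢ n → r′ v + suc l < n
  ≢top v off ≢n = subst (_< n) (sym (+-suc _ l)) (≤∧≢⇒< (proj₁ (proj₂ rec) v off) ≢n)

  r′-inj : ∀ u v → (∀ i → p (suc i) ≢ u) → (∀ i → p (suc i) ≢ v) → r′ u ≡ r′ v → u ≡ v
  r′-inj = proj₂ (proj₂ rec)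

  r-bound : ∀ v → (∀ i → p i ≢ v) → r v + suc l < n
  r-bound v off with suc (r′ v + l) ≟ n
  ... | no ≢n = ≢top v (off ∘ suc) ≢n
  ... | yes ≡n = ≢top (p zero) off₀ λ eq →
        off zero (r′-inj _ _ off₀ (off ∘ suc) (+-cancelʳ-≡ l _ _ (suc-injective (trans eq (sym ≡n)))))

  r-inj : ∀ u v → (∀ i → p i ≢ u) → (∀ i → p i ≢ v) → r u ≡ r v → u ≡ v
  r-inj u v offu offv with suc (r′ u + l) ≟ n | suc (r′ v + l) ≟ n
  ... | yes a | yes b = λ _ → r′-inj _ _ (offu ∘ suc) (offv ∘ suc)
                                (+-cancelʳ-≡ l _ _ (suc-injective (trans a (sym b))))
  ... | yes _ | no  _ = λ eq → contradiction (r′-inj _ _ off₀ (offv ∘ suc) eq) (offv zero)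
  ... | no  _ | yes _ = λ eq → contradiction (r′-inj _ _ off₀ (offu ∘ suc) (sym eq)) (offu zero)
  ... | no  _ | no  _ = r′-inj _ _ (offu ∘ suc) (offv ∘ suc)

module _ {n : ℕ} (G : FinGroup n) where

  ≤maxL : ∀ f v → f v ≤ maxL G f
  ≤maxL f v = ∈⇒≤foldr-⊔ (∈-map⁺ f (∈-allFin v))

  minL≤ : ∀ f v → minL G f ≤ f v
  minL≤ f v = ∈⇒foldr-⊓≤ (∈-map⁺ f (∈-allFin v))

  span-≤ : ∀ f {b} → (∀ v → f v ≤ b) → span G f ≤ b
  span-≤ f f≤b = ≤-trans (m∸n≤m _ (minL G f)) (foldr-⊔-≤ f f≤b (allFin n))

  spread≤span : ∀ f u v → f v ≤ span G f + f u
  spread≤span f u v = begin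
    f v                            ≤⟨ ≤maxL f v ⟩
    maxL G f                       ≤⟨ m≤n+m∸n (maxL G f) (minL G f) ⟩
    minL G f + (span G f)          ≤⟨ +-monoˡ-≤ (span G f) (minL≤ f u) ⟩
    f u + span G f                 ≡⟨ +-comm (f u) _ ⟩
    span G f + f u                 ∎
    where open ≤-Reasoning

  -- A path with `l` vertices in the complement of the power graph. Only consecutive vertices are
  -- constrained, and along them labels may grow in steps of 1.
  record CoPath (l : ℕ) : Set where
    field
      vertex    : Fin l → Fin n
      injective : Injective _≡_ _≡_ vertex
      non-adj   : ∀ i j → toℕ j ≡ suc (toℕ i) → ¬ Adj G (vertex i) (vertex j)

  Adj-sym : ∀ {u v} → Adj G u v → Adj G v u
  Adj-sym (u≢v , inj₁ h) = u≢v ∘ sym , inj₂ h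
  Adj-sym (u≢v , inj₂ h) = u≢v ∘ sym , inj₁ h

  module PathLabeling {l} (P : CoPath l) where
    open CoPath P renaming (vertex to p; injective to p-inj)

    rank : Fin n → ℕ
    rank = proj₁ (enumerate-complement l p p-inj)

    label : Fin n → ℕ
    label v with any? (λ i → p i Fin.≟ v)
    ... | yes (i , _) = toℕ i
    -- The last path vertex has label l - 1, so l + 1 is the first label above the path with a gap
    -- of 2. From there on labels grow in steps of 2.
    ... | no  _       = suc l + 2 * rank v

    path-apart-rest : ∀ (i : Fin l) k → 2 + toℕ i ≤ suc l + 2 * k
    path-apart-rest i k = ≤-trans (s≤s (toℕ<n i)) (m≤m+n (suc l) _)

    rest-gap : ∀ {a b} → a < b → 2 + (suc l + 2 * a) ≤ suc l + 2 * b
    rest-gap {a} {b} a<b = begin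
      2 + (suc l + 2 * a) ≡⟨ eq l a ⟩
      suc l + 2 * suc a   ≤⟨ +-monoʳ-≤ (suc l) (*-monoʳ-≤ 2 a<b) ⟩
      suc l + 2 * b       ∎
      where
      open ≤-Reasoning
      eq : ∀ l a → 2 + (suc l + 2 * a) ≡ suc l + 2 * suc a
      eq = solve-∀

    rest-apart : ∀ {a b} → a ≢ b → Apart (suc l + 2 * a) (suc l + 2 * b)
    rest-apart {a} {b} a≢b with <-cmp a b
    ... | tri< a<b _ _ = inj₁ (rest-gap a<b)
    ... | tri≈ _ a≡b _ = contradiction a≡b a≢b
    ... | tri> _ _ b<a = inj₂ (rest-gap b<a)

    label-apart : ∀ u v → Adj G u v → Apart (label u) (label v)
    label-apart u v adj with any? (λ i → p i Fin.≟ u) | any? (λ i → p i Fin.≟ v)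
    ... | yes (i , refl) | no _           = inj₁ (path-apart-rest i (rank v))
    ... | no _           | yes (j , refl) = inj₂ (path-apart-rest j (rank u))
    ... | no u∉          | no v∉          =
      rest-apart λ eq → proj₁ adj (proj₂ (proj₂ (enumerate-complement l p p-inj)) u v
        (λ i e → u∉ (i , e)) (λ i e → v∉ (i , e)) eq)
    ... | yes (i , refl) | yes (j , refl) with <-cmp (toℕ i) (toℕ j)
    ...   | tri≈ _ i≡j _ = contradiction (cong p (toℕ-injective i≡j)) (proj₁ adj)
    -- Two path labels that differ by just 1 belong to consecutive, hence non-adjacent, vertices.
    ...   | tri< i<j _ _ = inj₁ (≤∧≢⇒< i<j λ eq → non-adj i j (sym eq) adj)
    ...   | tri> _ _ j<i = inj₂ (≤∧≢⇒< j<i λ eq → non-adj j i (sym eq) (Adj-sym adj))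

    -- This settles the condition at distance two without examining any distances.
    label-injective : ∀ u v → u ≢ v → label u ≢ label v
    label-injective u v u≢v with any? (λ i → p i Fin.≟ u) | any? (λ i → p i Fin.≟ v)
    ... | yes (i , refl) | yes (j , refl) = u≢v ∘ cong p ∘ toℕ-injective
    ... | yes (i , refl) | no _           = Apart⇒≢ (inj₁ (path-apart-rest i (rank v)))
    ... | no _           | yes (j , refl) = Apart⇒≢ (inj₂ (path-apart-rest j (rank u)))
    ... | no u∉          | no v∉          =
      Apart⇒≢ (rest-apart λ eq → u≢v (proj₂ (proj₂ (enumerate-complement l p p-inj)) u v
        (λ i e → u∉ (i , e)) (λ i e → v∉ (i , e)) eq))

    label-L21 : IsL21 G label
    label-L21 = label-apart , λ u v d → label-injective u v (proj₁ d)

    -- Off the path the rank is at most n - l - 1, so the label is at most (l + 1) + 2(n - l - 1) =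
    -- 2n - (l + 1). On the path the label is below l, and l ≤ n suffices.
    label-bound : ∀ v → label v + suc l ≤ 2 * n
    label-bound v with any? (λ i → p i Fin.≟ v)
    ... | yes (i , _) = begin
      toℕ i + suc l   ≡⟨ +-suc (toℕ i) l ⟩
      suc (toℕ i) + l ≤⟨ +-monoˡ-≤ l (toℕ<n i) ⟩
      l + l           ≤⟨ +-mono-≤ l≤n (≤-trans l≤n (m≤m+n n 0)) ⟩
      2 * n           ∎
      where
      open ≤-Reasoning
      l≤n : l ≤ n
      l≤n = injective⇒≤ p-inj
    ... | no v∉ = begin
      suc l + 2 * rank v + suc l ≡⟨ eq l (rank v) ⟩
      2 * suc (rank v + l)       ≤⟨ *-monoʳ-≤ 2 (proj₁ (proj₂ (enumerate-complement l p p-inj)) v λ i e → v∉ (i , e)) ⟩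
      2 * n                      ∎
      where
      open ≤-Reasoning
      eq : ∀ l r → suc l + 2 * r + suc l ≡ 2 * suc (r + l)
      eq = solve-∀

    span-label : span G label ≤ 2 * n ∸ suc l
    span-label = span-≤ label (λ v → m+n≤o⇒m≤o∸n (label v) (label-bound v))

⌊/2⌋-separates : ∀ a b → Apart a b → ⌊ a /2⌋ ≢ ⌊ b /2⌋
⌊/2⌋-separates a b (inj₁ h) eq = <⇒≢ (⌊n/2⌋-mono h) eq
⌊/2⌋-separates a b (inj₂ h) eq = <⇒≢ (⌊n/2⌋-mono h) (sym eq)

-- Halving the labels of a clique is injective.
almost-complete⇒span : ∀ {n} (G : FinGroup n) t →
  (∀ u v → u ≢ t → v ≢ t → u ≢ v → Adj G u v) →
  ∀ f → IsL21 G f → 2 * n ∸ 4 ≤ span G f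
almost-complete⇒span {suc m} G t complete f (apart , _) = begin
  2 * suc m ∸ 4            ≤⟨ ∸-monoˡ-≤ 4 (*-monoʳ-≤ 2 (s≤s m≤)) ⟩
  2 * (2 + s) ∸ 4          ≡⟨ cong (_∸ 4) (eq s) ⟩
  4 + (s + s) ∸ 4          ≡⟨⟩
  s + s                    ≤⟨ +-monoʳ-≤ s (⌊n/2⌋≤⌈n/2⌉ (span G f)) ⟩
  s + ⌈ span G f /2⌉       ≡⟨ ⌊n/2⌋+⌈n/2⌉≡n (span G f) ⟩
  span G f                 ∎
  where
  open ≤-Reasoning
  s = ⌊ span G f /2⌋
  eq : ∀ s → 2 * (2 + s) ≡ 4 + (s + s)
  eq = solve-∀
  -- After this shift the labels lie between 0 and the span, so their halves take at most `suc s`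
  -- values. The `m` vertices other than `t` form a clique, whence `m ≤ suc s`.
  h : Fin (suc m) → ℕ
  h v = f v ∸ minL G f
  half : ∀ i → ⌊ h (punchIn t i) /2⌋ < suc s
  half i = s≤s (⌊n/2⌋-mono (∸-monoˡ-≤ (minL G f) (≤maxL G f _)))
  shift : ∀ u v → 2 + f u ≤ f v → 2 + h u ≤ h v
  shift u v le = subst (_≤ h v) (+-∸-assoc 2 (minL≤ G f u)) (∸-monoˡ-≤ (minL G f) le)
  h-apart : ∀ u v → Apart (f u) (f v) → Apart (h u) (h v)
  h-apart u v (inj₁ le) = inj₁ (shift u v le)
  h-apart u v (inj₂ le) = inj₂ (shift v u le)
  k : Fin m → Fin (suc s)
  k i = fromℕ< (half i)
  k-inj : Injective _≡_ _≡_ k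
  k-inj {i} {j} e with i Fin.≟ j
  ... | yes i≡j = i≡j
  ... | no  i≢j = contradiction (fromℕ<-injective _ _ (half i) (half j) e)
    (⌊/2⌋-separates _ _ (h-apart _ _ (apart _ _
      (complete _ _ (punchInᵢ≢i t i) (punchInᵢ≢i t j) (i≢j ∘ punchIn-injective t i j)))))
  m≤ : m ≤ suc s
  m≤ = injective⇒≤ k-inj

-- Powers, involutions and non-adjacency

linked-lookup : ∀ {A : Set} {R : A → A → Set} {l} {xs : Vec A l} → Linked R xs →
  ∀ i j → toℕ j ≡ suc (toℕ i) → R (Vec.lookup xs i) (Vec.lookup xs j)
linked-lookup {xs = _ ∷ _ ∷ _} (r ∷ rs) zero    (suc zero)    _  = r
linked-lookup (r ∷ rs) (suc i) (suc j)       eq = linked-lookup rs i j (suc-injective eq)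
linked-lookup [-]      zero    zero          ()

even⊎odd : ∀ m → (∃[ c ] m ≡ c * 2) ⊎ (∃[ c ] m ≡ 1 + c * 2)
even⊎odd zero = inj₁ (0 , refl)
even⊎odd (suc m) with even⊎odd m
... | inj₁ (c , refl) = inj₂ (c , refl)
... | inj₂ (c , refl) = inj₁ (suc c , refl)

module PowerGraph {n : ℕ} (G : FinGroup n) where
  open FinGroup G
  open IsGroup isGroup using (assoc; identityˡ; identityʳ; inverseˡ; inverseʳ)

  group : Group _ _
  group = record { isGroup = isGroup }

  open GroupProperties group

  infix  4 _∈⟨_⟩ _∥_
  infixl 30 _↑_

  _↑_ : Fin n → ℕ → Fin n
  _↑_ = pow G

  _∈⟨_⟩ : Fin n → Fin n → Set
  x ∈⟨ y ⟩ = ∃[ k ] x ≡ y ↑ k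

  _∥_ : Fin n → Fin n → Set
  x ∥ y = ¬ x ∈⟨ y ⟩ × ¬ y ∈⟨ x ⟩

  ↑-+ : ∀ x i j → x ↑ (i + j) ≡ (x ↑ i) ∙ (x ↑ j)
  ↑-+ x zero    j = sym (identityˡ _)
  ↑-+ x (suc i) j = trans (cong (x ∙_) (↑-+ x i j)) (sym (assoc x _ _))

  ε↑ : ∀ k → ε ↑ k ≡ ε
  ε↑ zero    = refl
  ε↑ (suc k) = trans (identityˡ _) (ε↑ k)

  ↑-* : ∀ x i j → x ↑ (i * j) ≡ (x ↑ j) ↑ i
  ↑-* x zero    j = refl
  ↑-* x (suc i) j = trans (↑-+ x j (i * j)) (cong ((x ↑ j) ∙_) (↑-* x i j))

  ↑-*′ : ∀ x i j → x ↑ (i * j) ≡ (x ↑ i) ↑ j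
  ↑-*′ x i j = trans (cong (x ↑_) (*-comm i j)) (↑-* x j i)

  ↑1 : ∀ x → x ↑ 1 ≡ x
  ↑1 = identityʳ

  ↑-multiple : ∀ x {d} → x ↑ d ≡ ε → ∀ k → x ↑ (k * d) ≡ ε
  ↑-multiple x {d} eq k = trans (↑-* x k d) (trans (cong (_↑ k) eq) (ε↑ k))

  ↑-∣ : ∀ x {d k} → x ↑ d ≡ ε → d ∣ k → x ↑ k ≡ ε
  ↑-∣ x eq (divides q refl) = ↑-multiple x eq q

  ↑-% : ∀ x {d} .{{_ : NonZero d}} → x ↑ d ≡ ε → ∀ k → x ↑ (k % d) ≡ x ↑ k
  ↑-% x {d} eq k = begin
    x ↑ (k % d)                           ≡⟨ identityʳ _ ⟨
    (x ↑ (k % d)) ∙ ε                     ≡⟨ cong ((x ↑ (k % d)) ∙_) (↑-multiple x eq (k / d)) ⟨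
    (x ↑ (k % d)) ∙ (x ↑ ((k / d) * d))   ≡⟨ ↑-+ x (k % d) _ ⟨
    x ↑ (k % d + (k / d) * d)             ≡⟨ cong (x ↑_) (m≡m%n+[m/n]*n k d) ⟨
    x ↑ k                                 ∎
    where open ≡-Reasoning

  ↑-∸ : ∀ x {i j} → i ≤ j → x ↑ i ≡ x ↑ j → x ↑ (j ∸ i) ≡ ε
  ↑-∸ x {i} {j} i≤j eq = ∙-cancelˡ (x ↑ i) _ _ (begin
    (x ↑ i) ∙ (x ↑ (j ∸ i)) ≡⟨ ↑-+ x i (j ∸ i) ⟨
    x ↑ (i + (j ∸ i))       ≡⟨ cong (x ↑_) (m+[n∸m]≡n i≤j) ⟩
    x ↑ j                   ≡⟨ eq ⟨
    x ↑ i                   ≡⟨ identityʳ _ ⟨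
    (x ↑ i) ∙ ε             ∎)
    where open ≡-Reasoning

  -- Two of the n + 1 powers with exponents 0, ..., n coincide. The bound by `n` is what later makes
  -- the search for exponents finite.
  torsion : ∀ x → ∃[ d ] (suc d ≤ n × x ↑ suc d ≡ ε)
  torsion x with pigeonhole (n<1+n n) (λ i → x ↑ toℕ i)
  ... | i , j , i<j , eq with toℕ j ∸ toℕ i in d≡ | ↑-∸ x (<⇒≤ i<j) eq
  ...   | zero  | _  = contradiction (m∸n≡0⇒m≤n d≡) (<⇒≱ i<j)
  ...   | suc d | x↑ = d , subst (_≤ n) d≡ (≤-trans (m∸n≤m (toℕ j) (toℕ i)) (≤-pred (toℕ<n j))) , x↑

  ∈-refl : ∀ {x} → x ∈⟨ x ⟩
  ∈-refl {x} = 1 , sym (↑1 x)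

  ∈-trans : ∀ {x y z} → x ∈⟨ y ⟩ → y ∈⟨ z ⟩ → x ∈⟨ z ⟩
  ∈-trans {z = z} (i , refl) (j , refl) = i * j , sym (↑-* z i j)

  ∈-ε : ∀ {x} → ε ∈⟨ x ⟩
  ∈-ε = 0 , refl

  ∈-∙ : ∀ {x y z} → x ∈⟨ z ⟩ → y ∈⟨ z ⟩ → x ∙ y ∈⟨ z ⟩
  ∈-∙ {z = z} (i , refl) (j , refl) = i + j , sym (↑-+ z i j)

  ∈-⁻¹ : ∀ {x} → x ⁻¹ ∈⟨ x ⟩
  ∈-⁻¹ {x} with torsion x
  ... | d , _ , eq = d , sym (inverseʳ-unique x (x ↑ d) eq)

  ⁻¹-∈ : ∀ {x} → x ∈⟨ x ⁻¹ ⟩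
  ⁻¹-∈ {x} = subst (_∈⟨ x ⁻¹ ⟩) (⁻¹-involutive x) ∈-⁻¹

  -- In the cyclic case this refutes memberships: an exponent that kills `y` but not `x` keeps `x`
  -- out of the subgroup generated by `y`.
  ∈-exponent : ∀ {x y} → x ∈⟨ y ⟩ → ∀ m → y ↑ m ≡ ε → x ↑ m ≡ ε
  ∈-exponent {y = y} (k , refl) m eq =
    trans (sym (↑-* y m k)) (trans (cong (y ↑_) (*-comm m k)) (↑-multiple y eq k))

  -- Exponents may be reduced modulo the torsion exponent of `y`, which is at most `n`, so exponents
  -- below `n` suffice.
  _∈⟨_⟩? : ∀ x y → Dec (x ∈⟨ y ⟩)
  x ∈⟨ y ⟩? = map′ (λ (k , eq) → toℕ k , eq) to (any? (λ (k : Fin n) → x Fin.≟ y ↑ toℕ k))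
    where
    to : x ∈⟨ y ⟩ → ∃[ k ] x ≡ y ↑ toℕ {n} k
    to (k , eq) with torsion y
    ... | d , d<n , y↑ = fromℕ< k<n , trans eq (trans (sym (↑-% y y↑ k)) (cong (y ↑_) (sym (toℕ-fromℕ< k<n))))
      where
      k<n : k % suc d < n
      k<n = <-≤-trans (m%n<n k (suc d)) d<n

  ∥-sym : ∀ {x y} → x ∥ y → y ∥ x
  ∥-sym (a , b) = b , a

  ∥⇒≢ : ∀ {x y} → x ∥ y → x ≢ y
  ∥⇒≢ (a , _) refl = a ∈-refl

  ∥⇒¬Adj : ∀ {x y} → x ∥ y → ¬ Adj G x y
  ∥⇒¬Adj (a , b) (_ , inj₁ h) = b h
  ∥⇒¬Adj (a , b) (_ , inj₂ h) = a h

  ∥-⁻¹ : ∀ {x y} → x ∥ y → x ∥ y ⁻¹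
  ∥-⁻¹ (a , b) = (λ h → a (∈-trans h ∈-⁻¹)) , (λ h → b (∈-trans ⁻¹-∈ h))

  Adj? : ∀ u v → Dec (Adj G u v)
  Adj? u v = ¬? (u Fin.≟ v) ×-dec (v ∈⟨ u ⟩? ⊎-dec u ∈⟨ v ⟩?)

  -- Distinct non-adjacent vertices are at distance two through `ε`, the zeroth power of every
  -- element.
  L21-injective : ∀ f → IsL21 G f → ∀ u v → u ≢ v → f u ≢ f v
  L21-injective f (apart , distinct) u v u≢v with Adj? u v
  ... | yes adj = Apart⇒≢ (apart u v adj)
  ... | no ¬adj = distinct u v (u≢v , ¬adj , ε , (u≢ε , inj₁ ∈-ε) , (v≢ε ∘ sym , inj₂ ∈-ε))
    where
    u≢ε : u ≢ ε
    u≢ε refl = ¬adj (u≢v , inj₂ ∈-ε)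
    v≢ε : v ≢ ε
    v≢ε refl = ¬adj (u≢v , inj₁ ∈-ε)

  -- Paths in the complement built from incomparable elements

  path : ∀ {l} (xs : Vec (Fin n) l) → Unique xs → Linked _∥_ xs → CoPath G l
  path xs uniq linked = record
    { vertex    = Vec.lookup xs
    ; injective = λ {i} {j} → lookup-injective uniq i j
    ; non-adj   = λ i j eq → ∥⇒¬Adj (linked-lookup linked i j eq)
    }

  path₃ : ∀ {a b c} → a ∥ b → b ∥ c → a ≢ c → CoPath G 3
  path₃ {a} {b} {c} ab bc a≢c = path (a ∷ b ∷ c ∷ [])
    ((∥⇒≢ ab ∷ a≢c ∷ []) ∷ (∥⇒≢ bc ∷ []) ∷ [] ∷ []) (ab ∷ bc ∷ [-])

  path₄ : ∀ {a b c d} → a ∥ b → b ∥ c → c ∥ d → a ≢ c → a ≢ d → b ≢ d → CoPath G 4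
  path₄ {a} {b} {c} {d} ab bc cd a≢c a≢d b≢d = path (a ∷ b ∷ c ∷ d ∷ [])
    ((∥⇒≢ ab ∷ a≢c ∷ a≢d ∷ []) ∷ (∥⇒≢ bc ∷ b≢d ∷ []) ∷ (∥⇒≢ cd ∷ []) ∷ [] ∷ []) (ab ∷ bc ∷ cd ∷ [-])

  ≢-⁻¹ : ∀ {x} → x ∙ x ≢ ε → x ≢ x ⁻¹
  ≢-⁻¹ {x} xx≢ε eq = xx≢ε (trans (cong (x ∙_) eq) (inverseʳ x))

  -- An element and its inverse generate the same subgroup, so inverting either element keeps the
  -- pair incomparable. The hypotheses on squares keep each element distinct from its inverse.
  ∥⇒path₄ : ∀ {x y} → x ∥ y → x ∙ x ≢ ε → y ∙ y ≢ ε → CoPath G 4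
  ∥⇒path₄ {x} {y} x∥y xx yy =
    path₄ x∥y (∥-⁻¹ (∥-sym x∥y)) (∥-⁻¹ (∥-sym (∥-⁻¹ (∥-sym x∥y)))) (≢-⁻¹ xx) (∥⇒≢ (∥-⁻¹ x∥y)) (≢-⁻¹ yy)

  Involution : Fin n → Set
  Involution x = x ≢ ε × x ∙ x ≡ ε

  Involution? : ∀ x → Dec (Involution x)
  Involution? x = ¬? (x Fin.≟ ε) ×-dec (x ∙ x Fin.≟ ε)

  ∈-involution : ∀ {x s} → Involution s → x ∈⟨ s ⟩ → x ≡ ε ⊎ x ≡ s
  ∈-involution {s = s} (_ , ss) (zero  , refl) = inj₁ refl
  ∈-involution {s = s} inv@(_ , ss) (suc k , refl) with ∈-involution inv (k , refl)
  ... | inj₁ eq = inj₂ (trans (cong (s ∙_) eq) (identityʳ s))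
  ... | inj₂ eq = inj₁ (trans (cong (s ∙_) eq) ss)

  -- The subgroup generated by `s` is just `ε` and `s`, so one of the two non-memberships is
  -- automatic.
  ∥-involution : ∀ {x s} → Involution s → x ≢ ε → x ≢ s → ¬ s ∈⟨ x ⟩ → x ∥ s
  ∥-involution inv x≢ε x≢s s∉ = (λ h → [ x≢ε , x≢s ]′ (∈-involution inv h)) , s∉

  involutions-∥ : ∀ {s t} → Involution s → Involution t → s ≢ t → s ∥ t
  involutions-∥ is it s≢t = ∥-involution it (proj₁ is) s≢t
    λ h → [ proj₁ it , s≢t ∘ sym ]′ (∈-involution is h)

  involution-left-cancel : ∀ {s} → Involution s → ∀ x → s ∙ (s ∙ x) ≡ x
  involution-left-cancel {s} (_ , ss) x = trans (sym (assoc s s x)) (trans (cong (_∙ x) ss) (identityˡ x))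

  involution-inverse : ∀ {s t} → Involution s → s ∙ t ≡ ε → s ≡ t
  involution-inverse {s} {t} is st = ∙-cancelˡ s s t (trans (proj₂ is) (sym st))

  -- Subtractive Euclid on the exponents.
  subtract-involution : ∀ x i k → (Involution (x ↑ i) → Involution (x ↑ k) → x ↑ i ≡ x ↑ k) →
    Involution (x ↑ i) → Involution (x ↑ (i + k)) → x ↑ i ≡ x ↑ (i + k)
  subtract-involution x i k rec inv-i inv-j with x ↑ k Fin.≟ ε
  ... | yes x↑k≡ε = sym (trans (↑-+ x i k) (trans (cong ((x ↑ i) ∙_) x↑k≡ε) (identityʳ _)))
  -- Here `x ↑ k` is an involution as well, so it equals `x ↑ i` by `rec`. Then `x ↑ (i + k)` is the
  -- square of `x ↑ i`, which is `ε`.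
  ... | no  x↑k≢ε = contradiction
    (trans (↑-+ x i k) (trans (cong ((x ↑ i) ∙_) (sym (rec inv-i (x↑k≢ε , square)))) (proj₂ inv-i)))
    (proj₁ inv-j)
    where
    open ≡-Reasoning
    rearrange : ∀ i k → (i + k) + (i + k) ≡ (i + i) + (k + k)
    rearrange = solve-∀
    square : (x ↑ k) ∙ (x ↑ k) ≡ ε
    square = begin
      (x ↑ k) ∙ (x ↑ k)                 ≡⟨ ↑-+ x k k ⟨
      x ↑ (k + k)                       ≡⟨ identityˡ _ ⟨
      ε ∙ (x ↑ (k + k))                 ≡⟨ cong (_∙ (x ↑ (k + k))) (trans (↑-+ x i i) (proj₂ inv-i)) ⟨
      (x ↑ (i + i)) ∙ (x ↑ (k + k))     ≡⟨ ↑-+ x (i + i) (k + k) ⟨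
      x ↑ ((i + i) + (k + k))           ≡⟨ cong (x ↑_) (rearrange i k) ⟨
      x ↑ ((i + k) + (i + k))           ≡⟨ ↑-+ x (i + k) (i + k) ⟩
      (x ↑ (i + k)) ∙ (x ↑ (i + k))     ≡⟨ proj₂ inv-j ⟩
      ε                                 ∎

  -- The number `m` bounds the sum of the exponents. Each subtraction lowers that sum, because an
  -- exponent 0 would give `ε` and not an involution.
  ↑-unique-involution : ∀ x m i j → i + j ≤ m → Involution (x ↑ i) → Involution (x ↑ j) → x ↑ i ≡ x ↑ j
  ↑-unique-involution x m zero j _ (≢ε , _) _ = contradiction refl ≢ε
  ↑-unique-involution x m (suc i) zero _ _ (≢ε , _) = contradiction refl ≢ε
  ↑-unique-involution x (suc m) (suc i) (suc j) (s≤s le) inv-i inv-j with ≤-total (suc i) (suc j)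
  ... | inj₁ i≤j with k , refl ← m≤n⇒∃[o]m+o≡n i≤j =
    subtract-involution x (suc i) k (↑-unique-involution x m (suc i) k (m+n≤o⇒n≤o i le)) inv-i inv-j
  ... | inj₂ j≤i with k , refl ← m≤n⇒∃[o]m+o≡n j≤i =
    sym (subtract-involution x (suc j) k
      (↑-unique-involution x m (suc j) k (m+n≤o⇒n≤o j (subst (_≤ m) (rearrange j k) le))) inv-j inv-i)
    where
    rearrange : ∀ j k → j + k + suc j ≡ j + (suc j + k)
    rearrange = solve-∀

  ⟨⟩-unique-involution : ∀ {x s t} → s ∈⟨ x ⟩ → t ∈⟨ x ⟩ → Involution s → Involution t → s ≡ t
  ⟨⟩-unique-involution {x} (i , refl) (j , refl) = ↑-unique-involution x (i + j) i j ≤-refl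

  -- The powers of `x` include at most one involution, so `x` is incomparable to at least two of
  -- `r`, `s`, `t`. The path starts with the remaining involution and passes through `x` between
  -- those two.
  three-involutions : ∀ {r s t x} → Involution r → Involution s → Involution t →
    r ≢ s → r ≢ t → s ≢ t → x ≢ ε → x ≢ r → x ≢ s → x ≢ t → CoPath G 4
  three-involutions {r} {s} {t} {x} ir is it r≢s r≢t s≢t x≢ε x≢r x≢s x≢t
    with s ∈⟨ x ⟩? | t ∈⟨ x ⟩?
  ... | no s∉ | no t∉ =
    path₄ (involutions-∥ ir is r≢s) (∥-sym (∥-involution is x≢ε x≢s s∉)) (∥-involution it x≢ε x≢t t∉)
      (x≢r ∘ sym) r≢t s≢t
  ... | yes s∈ | _ =
    path₄ (involutions-∥ is it s≢t)
      (∥-sym (∥-involution it x≢ε x≢t λ t∈ → s≢t (⟨⟩-unique-involution s∈ t∈ is it)))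
      (∥-involution ir x≢ε x≢r λ r∈ → r≢s (⟨⟩-unique-involution r∈ s∈ ir is))
      (x≢s ∘ sym) (r≢s ∘ sym) (r≢t ∘ sym)
  ... | no s∉ | yes t∈ =
    path₄ (involutions-∥ it is (s≢t ∘ sym)) (∥-sym (∥-involution is x≢ε x≢s s∉))
      (∥-involution ir x≢ε x≢r λ r∈ → r≢t (⟨⟩-unique-involution r∈ t∈ ir it))
      (x≢t ∘ sym) (r≢t ∘ sym) (r≢s ∘ sym)

  -- For both model groups the map `ψ` into `G` has an explicit formula. Injectivity of `ψ`
  -- transfers its homomorphism law to `φ`.
  isoFromInverse : ∀ {A : Set} (_⊕_ : A → A → A) (ψ : A → Fin n) (φ : Fin n → A) →
    (∀ x → ψ (φ x) ≡ x) → Injective _≡_ _≡_ ψ → (∀ a b → ψ (a ⊕ b) ≡ ψ a ∙ ψ b) → IsoTo G A _⊕_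
  isoFromInverse _⊕_ ψ φ ψφ ψ-inj ψ-hom =
    φ , ψ , ψφ , (λ a → ψ-inj (ψφ (ψ a))) ,
    λ x y → ψ-inj (trans (ψφ (x ∙ y)) (sym (trans (ψ-hom _ _) (cong₂ _∙_ (ψφ x) (ψφ y)))))

  -- Groups with two distinct involutions

  module TwoInvolutions {s t} (is : Involution s) (it : Involution t) (s≢t : s ≢ t) where

    st≢ε : s ∙ t ≢ ε
    st≢ε eq = s≢t (involution-inverse is eq)

    st≢s : s ∙ t ≢ s
    st≢s eq = proj₁ it (identityʳ-unique s t eq)

    st≢t : s ∙ t ≢ t
    st≢t eq = proj₁ is (identityˡ-unique s t eq)

    -- The conjugate of `t` by `s` is a third involution, different from `t` because `s` and `t` do
    -- not commute. The product `s ∙ t` serves as the fourth nontrivial element.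
    non-commuting : s ∙ t ≢ t ∙ s → CoPath G 4
    non-commuting st≢ts = three-involutions ir is it r≢s r≢t s≢t st≢ε x≢r st≢s st≢t
      where
      open ≡-Reasoning
      r = s ∙ (t ∙ s)
      sr : s ∙ r ≡ t ∙ s
      sr = involution-left-cancel is (t ∙ s)
      r≢ε : r ≢ ε
      r≢ε eq = proj₁ it (identityˡ-unique t s (trans (sym sr) (trans (cong (s ∙_) eq) (identityʳ s))))
      rr : r ∙ r ≡ ε
      rr = begin
        (s ∙ (t ∙ s)) ∙ r   ≡⟨ assoc s (t ∙ s) r ⟩
        s ∙ ((t ∙ s) ∙ r)   ≡⟨ cong (s ∙_) (assoc t s r) ⟩
        s ∙ (t ∙ (s ∙ r))   ≡⟨ cong (λ z → s ∙ (t ∙ z)) sr ⟩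
        s ∙ (t ∙ (t ∙ s))   ≡⟨ cong (s ∙_) (involution-left-cancel it s) ⟩
        s ∙ s               ≡⟨ proj₂ is ⟩
        ε                   ∎
      ir : Involution r
      ir = r≢ε , rr
      r≢s : r ≢ s
      r≢s eq = s≢t (sym (involution-inverse it (identityʳ-unique s (t ∙ s) eq)))
      r≢t : r ≢ t
      r≢t eq = st≢ts (trans (cong (s ∙_) (sym eq)) sr)
      x≢r : s ∙ t ≢ r
      x≢r eq = proj₁ is (identityʳ-unique t s (sym (∙-cancelˡ s _ _ eq)))

    module _ (comm : s ∙ t ≡ t ∙ s) where

      st-involution : Involution (s ∙ t)
      st-involution = st≢ε , (begin
        (s ∙ t) ∙ (s ∙ t)  ≡⟨ cong (_∙ (s ∙ t)) comm ⟩
        (t ∙ s) ∙ (s ∙ t)  ≡⟨ assoc t s (s ∙ t) ⟩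
        t ∙ (s ∙ (s ∙ t))  ≡⟨ cong (t ∙_) (involution-left-cancel is t) ⟩
        t ∙ t              ≡⟨ proj₂ it ⟩
        ε                  ∎)
        where open ≡-Reasoning

      klein-path : CoPath G 3
      klein-path = path₃ (involutions-∥ st-involution is st≢s) (involutions-∥ is it s≢t) st≢t

      isoKlein : (∀ x → x ≡ ε ⊎ x ≡ s ⊎ x ≡ t ⊎ x ≡ s ∙ t) → IsoTo G (Fin 2 × Fin 2) klein
      isoKlein cover = isoFromInverse klein ψ (proj₁ ∘ inv) (proj₂ ∘ inv) ψ-inj ψ-hom
        where
        ψ : Fin 2 × Fin 2 → Fin n
        ψ (zero     , zero)     = ε
        ψ (suc zero , zero)     = s
        ψ (zero     , suc zero) = t
        ψ (suc zero , suc zero) = s ∙ t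

        inv : ∀ x → ∃[ a ] ψ a ≡ x
        inv x with cover x
        ... | inj₁ eq               = (zero , zero) , sym eq
        ... | inj₂ (inj₁ eq)        = (suc zero , zero) , sym eq
        ... | inj₂ (inj₂ (inj₁ eq)) = (zero , suc zero) , sym eq
        ... | inj₂ (inj₂ (inj₂ eq)) = (suc zero , suc zero) , sym eq

        ψ-inj : Injective _≡_ _≡_ ψ
        ψ-inj {zero , zero}         {zero , zero}         _  = refl
        ψ-inj {zero , zero}         {suc zero , zero}     eq = contradiction (sym eq) (proj₁ is)
        ψ-inj {zero , zero}         {zero , suc zero}     eq = contradiction (sym eq) (proj₁ it)
        ψ-inj {zero , zero}         {suc zero , suc zero} eq = contradiction (sym eq) st≢ε
        ψ-inj {suc zero , zero}     {zero , zero}         eq = contradiction eq (proj₁ is)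
        ψ-inj {suc zero , zero}     {suc zero , zero}     _  = refl
        ψ-inj {suc zero , zero}     {zero , suc zero}     eq = contradiction eq s≢t
        ψ-inj {suc zero , zero}     {suc zero , suc zero} eq = contradiction (sym eq) st≢s
        ψ-inj {zero , suc zero}     {zero , zero}         eq = contradiction eq (proj₁ it)
        ψ-inj {zero , suc zero}     {suc zero , zero}     eq = contradiction (sym eq) s≢t
        ψ-inj {zero , suc zero}     {zero , suc zero}     _  = refl
        ψ-inj {zero , suc zero}     {suc zero , suc zero} eq = contradiction (sym eq) st≢t
        ψ-inj {suc zero , suc zero} {zero , zero}         eq = contradiction eq st≢ε
        ψ-inj {suc zero , suc zero} {suc zero , zero}     eq = contradiction eq st≢s
        ψ-inj {suc zero , suc zero} {zero , suc zero}     eq = contradiction eq st≢t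
        ψ-inj {suc zero , suc zero} {suc zero , suc zero} _  = refl

        ts-s : t ∙ (s ∙ t) ≡ s
        ts-s = trans (cong (t ∙_) comm) (involution-left-cancel it s)

        ψ-hom : ∀ a b → ψ (klein a b) ≡ ψ a ∙ ψ b
        ψ-hom (zero , zero)         (zero , zero)         = sym (identityˡ _)
        ψ-hom (zero , zero)         (suc zero , zero)     = sym (identityˡ _)
        ψ-hom (zero , zero)         (zero , suc zero)     = sym (identityˡ _)
        ψ-hom (zero , zero)         (suc zero , suc zero) = sym (identityˡ _)
        ψ-hom (suc zero , zero)     (zero , zero)         = sym (identityʳ _)
        ψ-hom (suc zero , zero)     (suc zero , zero)     = sym (proj₂ is)
        ψ-hom (suc zero , zero)     (zero , suc zero)     = refl
        ψ-hom (suc zero , zero)     (suc zero , suc zero) = sym (involution-left-cancel is t)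
        ψ-hom (zero , suc zero)     (zero , zero)         = sym (identityʳ _)
        ψ-hom (zero , suc zero)     (suc zero , zero)     = comm
        ψ-hom (zero , suc zero)     (zero , suc zero)     = sym (proj₂ it)
        ψ-hom (zero , suc zero)     (suc zero , suc zero) = sym ts-s
        ψ-hom (suc zero , suc zero) (zero , zero)         = sym (identityʳ _)
        ψ-hom (suc zero , suc zero) (suc zero , zero)     =
          sym (trans (assoc s t s) (trans (cong (s ∙_) (sym comm)) (involution-left-cancel is t)))
        ψ-hom (suc zero , suc zero) (zero , suc zero)     =
          sym (trans (assoc s t t) (trans (cong (s ∙_) (proj₂ it)) (identityʳ s)))
        ψ-hom (suc zero , suc zero) (suc zero , suc zero) = sym (proj₂ st-involution)

    dichotomy : CoPath G 4 ⊎ (CoPath G 3 × IsoTo G (Fin 2 × Fin 2) klein)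
    dichotomy with s ∙ t Fin.≟ t ∙ s
    ... | no  st≢ts = inj₁ (non-commuting st≢ts)
    ... | yes comm
      with any? (λ x → ¬? (x Fin.≟ ε) ×-dec ¬? (x Fin.≟ s) ×-dec ¬? (x Fin.≟ t) ×-dec ¬? (x Fin.≟ s ∙ t))
    -- For commuting `s` and `t` the third involution is `s ∙ t`, and any element outside the Klein
    -- four-group they generate is the extra vertex.
    ...   | yes (x , x≢ε , x≢s , x≢t , x≢st) =
      inj₁ (three-involutions (st-involution comm) is it st≢s st≢t s≢t x≢ε x≢st x≢s x≢t)
    ...   | no none = inj₂ (klein-path comm , isoKlein comm cover)
      where
      cover : ∀ x → x ≡ ε ⊎ x ≡ s ⊎ x ≡ t ⊎ x ≡ s ∙ t
      cover x with x Fin.≟ ε | x Fin.≟ s | x Fin.≟ t | x Fin.≟ s ∙ t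
      ... | yes eq | _ | _ | _ = inj₁ eq
      ... | no _ | yes eq | _ | _ = inj₂ (inj₁ eq)
      ... | no _ | no _ | yes eq | _ = inj₂ (inj₂ (inj₁ eq))
      ... | no _ | no _ | no _ | yes eq = inj₂ (inj₂ (inj₂ eq))
      ... | no a | no b | no c | no d = contradiction (x , a , b , c , d) none

  -- Groups in which the elements that are not involutions form a chain

  module ComparableNonInvolutions
    (comparable : ∀ x y → x ∙ x ≢ ε → y ∙ y ≢ ε → x ∈⟨ y ⟩ ⊎ y ∈⟨ x ⟩)
    (unique : ∀ s t → Involution s → Involution t → s ≡ t) where

    -- The hypothesis `comparable` omits `ε`, whose square is trivial although it is no involution.
    -- It lies below everything.
    non-involution-comparable : ∀ x y → ¬ Involution x → ¬ Involution y → x ∈⟨ y ⟩ ⊎ y ∈⟨ x ⟩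
    non-involution-comparable x y ¬ix ¬iy with x Fin.≟ ε | y Fin.≟ ε
    ... | yes refl | _        = inj₁ ∈-ε
    ... | no _     | yes refl = inj₂ ∈-ε
    ... | no x≢ε   | no y≢ε   = comparable x y (λ xx → ¬ix (x≢ε , xx)) (λ yy → ¬iy (y≢ε , yy))

    greatest : ∀ xs → ∃[ g ] (¬ Involution g × (∀ {x} → x ∈ xs → ¬ Involution x → x ∈⟨ g ⟩))
    greatest [] = ε , (λ iε → proj₁ iε refl) , λ ()
    greatest (y ∷ ys) with greatest ys | Involution? y
    ... | g , ¬ig , ub | yes iy = g , ¬ig , λ { (here refl) ¬iy → contradiction iy ¬iy ; (there x∈) → ub x∈ }
    ... | g , ¬ig , ub | no ¬iy with non-involution-comparable y g ¬iy ¬ig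
    ...   | inj₁ y∈g = g , ¬ig , λ { (here refl) _ → y∈g ; (there x∈) → ub x∈ }
    ...   | inj₂ g∈y = y , ¬iy , λ { (here refl) _ → ∈-refl ; (there x∈) ¬ix → ∈-trans (ub x∈ ¬ix) g∈y }

    -- If t is the involution and g ≢ ε, then g ∙ t is not an involution, so g ∙ t and hence t lie in ⟨ g ⟩.
    cyclic : IsCyclic G
    cyclic with greatest (allFin n) | any? Involution?
    ... | g , ¬ig , ub | no none = g , λ x → ub (∈-allFin x) (λ ix → none (x , ix))
    ... | g , ¬ig , ub | yes (t , it) with g Fin.≟ ε
    -- Every element that is not an involution is now a power of `ε`, so the group consists of `ε`
    -- and `t`.
    ...   | yes refl = t , gen
      where
      gen : ∀ x → x ∈⟨ t ⟩
      gen x with Involution? x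
      ... | yes ix = subst (_∈⟨ t ⟩) (unique t x it ix) ∈-refl
      ... | no ¬ix = ∈-trans (ub (∈-allFin x) ¬ix) ∈-ε
    ...   | no g≢ε = g , gen
      where
      ¬igt : ¬ Involution (g ∙ t)
      ¬igt igt = g≢ε (identityˡ-unique g t (unique _ _ igt it))
      t∈ : t ∈⟨ g ⟩
      t∈ = subst (_∈⟨ g ⟩) (trans (sym (assoc _ _ _)) (trans (cong (_∙ t) (inverseˡ g)) (identityˡ t)))
             (∈-∙ ∈-⁻¹ (ub (∈-allFin (g ∙ t)) ¬igt))
      gen : ∀ x → x ∈⟨ g ⟩
      gen x with Involution? x
      ... | yes ix = subst (_∈⟨ g ⟩) (unique t x it ix) t∈
      ... | no ¬ix = ub (∈-allFin x) ¬ix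

  -- Finite searches look for two distinct involutions and for two incomparable elements with
  -- nontrivial squares. When both fail, the group is a chain apart from at most one involution.
  path₄-or-klein-or-cyclic : CoPath G 4 ⊎ (CoPath G 3 × IsoTo G (Fin 2 × Fin 2) klein) ⊎ IsCyclic G
  path₄-or-klein-or-cyclic
    with any? (λ s → any? (λ t → Involution? s ×-dec Involution? t ×-dec ¬? (s Fin.≟ t)))
       | any? (λ x → any? (λ y → ¬? (x ∙ x Fin.≟ ε) ×-dec ¬? (y ∙ y Fin.≟ ε) ×-dec ¬? (x ∈⟨ y ⟩?) ×-dec ¬? (y ∈⟨ x ⟩?)))
  ... | yes (s , t , is , it , s≢t) | _ = [ inj₁ , inj₂ ∘ inj₁ ]′ (TwoInvolutions.dichotomy is it s≢t)
  ... | no _ | yes (x , y , xx , yy , x∥y) = inj₁ (∥⇒path₄ x∥y xx yy)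
  ... | no one | no none = inj₂ (inj₂ (ComparableNonInvolutions.cyclic comparable unique))
    where
    comparable : ∀ x y → x ∙ x ≢ ε → y ∙ y ≢ ε → x ∈⟨ y ⟩ ⊎ y ∈⟨ x ⟩
    comparable x y xx yy with x ∈⟨ y ⟩? | y ∈⟨ x ⟩?
    ... | yes h | _     = inj₁ h
    ... | no _  | yes h = inj₂ h
    ... | no a  | no b  = contradiction (x , y , xx , yy , a , b) none
    unique : ∀ s t → Involution s → Involution t → s ≡ t
    unique s t is it with s Fin.≟ t
    ... | yes eq = eq
    ... | no s≢t = contradiction (s , t , is , it , s≢t) one

-- Cyclic groups

toℕ-zadd : ∀ {m} .{{_ : NonZero m}} (a b : Fin m) → toℕ (zadd a b) ≡ (toℕ a + toℕ b) % m
toℕ-zadd {suc k} a b = toℕ-fromℕ< (m%n<n (toℕ a + toℕ b) (suc k))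

module Cyclic {n : ℕ} (G : FinGroup n) (g : Fin n) (gen : ∀ x → ∃[ k ] x ≡ pow G g k) where
  open FinGroup G
  open IsGroup isGroup using (identityʳ)
  open PowerGraph G
  open GroupProperties group

  private instance
    n≢0 : NonZero n
    n≢0 = nonZeroIndex ε

  -- A discrete logarithm modulo `d`. The modulus is free because logarithms are taken modulo any
  -- exponent that kills `g`, before the order of `g` is known.
  log : ∀ d .{{_ : NonZero d}} → Fin n → Fin d
  log d x = fromℕ< (m%n<n (proj₁ (gen x)) d)

  g↑log : ∀ {d} .{{_ : NonZero d}} → g ↑ d ≡ ε → ∀ x → g ↑ toℕ (log d x) ≡ x
  g↑log {d} g↑d≡ε x = trans (cong (g ↑_) (toℕ-fromℕ< (m%n<n (proj₁ (gen x)) d)))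
    (trans (↑-% g g↑d≡ε (proj₁ (gen x))) (sym (proj₂ (gen x))))

  generator-order-≥ : ∀ e → g ↑ suc e ≡ ε → n ≤ suc e
  generator-order-≥ e g↑ = injective⇒≤ log-inj
    where
    log-inj : Injective _≡_ _≡_ (log (suc e))
    log-inj {x} {y} eq =
      trans (sym (g↑log g↑ x)) (trans (cong (λ i → g ↑ toℕ i) eq) (g↑log g↑ y))

  g↑n≡ε : g ↑ n ≡ ε
  g↑n≡ε with torsion g
  ... | d , d<n , eq = subst (λ m → g ↑ m ≡ ε) (≤-antisym d<n (generator-order-≥ d eq)) eq

  ↑≡ε⇒∣ : ∀ {k} → g ↑ k ≡ ε → n ∣ k
  ↑≡ε⇒∣ {k} eq = m%n≡0⇒n∣m k n (rem (k % n) (m%n<n k n) (trans (↑-% g g↑n≡ε k) eq))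
    where
    rem : ∀ r → r < n → g ↑ r ≡ ε → r ≡ 0
    rem zero    _   _  = refl
    rem (suc r) r<n eq = contradiction (generator-order-≥ r eq) (<⇒≱ r<n)

  iso-zadd : IsoTo G (Fin n) zadd
  iso-zadd = isoFromInverse zadd (λ a → g ↑ toℕ a) (log n) (g↑log g↑n≡ε) inj hom
    where
    inj-≤ : ∀ {i j} → i ≤ j → j < n → g ↑ i ≡ g ↑ j → i ≡ j
    inj-≤ {i} {j} i≤j j<n eq with j ≤? i
    ... | yes j≤i = ≤-antisym i≤j j≤i
    ... | no  j≰i = contradiction (≤-trans (∣⇒≤ {{>-nonZero (m<n⇒0<n∸m (≰⇒> j≰i))}} (↑≡ε⇒∣ (↑-∸ g i≤j eq))) (m∸n≤m j i)) (<⇒≱ j<n)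
    inj : ∀ {a b : Fin n} → g ↑ toℕ a ≡ g ↑ toℕ b → a ≡ b
    inj {a} {b} eq with ≤-total (toℕ a) (toℕ b)
    ... | inj₁ a≤b = toℕ-injective (inj-≤ a≤b (toℕ<n b) eq)
    ... | inj₂ b≤a = sym (toℕ-injective (inj-≤ b≤a (toℕ<n a) (sym eq)))
    hom : ∀ a b → g ↑ toℕ (zadd a b) ≡ (g ↑ toℕ a) ∙ (g ↑ toℕ b)
    hom a b = trans (cong (g ↑_) (toℕ-zadd a b)) (trans (↑-% g g↑n≡ε _) (↑-+ g (toℕ a) (toℕ b)))

  factors≢0 : ∀ a b → n ≡ a * b → NonZero a × NonZero b
  factors≢0 a b refl = m*n≢0⇒m≢0 a , m*n≢0⇒n≢0 a

  -- The exponent `b` kills `g ↑ a`, hence also `g ↑ b`. So `a * b` divides `b * b`, and `b`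
  -- cancels.
  g↑∈⇒∣ : ∀ {a b} → n ≡ a * b → g ↑ b ∈⟨ g ↑ a ⟩ → a ∣ b
  g↑∈⇒∣ {a} {b} n≡ h =
    *-cancelʳ-∣ b {{proj₂ (factors≢0 a b n≡)}} (subst (_∣ b * b) n≡ (↑≡ε⇒∣ (trans (↑-*′ g b b)
      (∈-exponent h b (trans (sym (↑-*′ g a b)) (subst (λ m → g ↑ m ≡ ε) n≡ g↑n≡ε))))))

  g↑-square : ∀ k → (g ↑ k) ∙ (g ↑ k) ≡ ε → n ∣ 2 * k
  g↑-square k eq = ↑≡ε⇒∣ (trans (cong (g ↑_) (cong (k +_) (+-identityʳ k))) (trans (↑-+ g k k) eq))

  -- The pair is `g ↑ b` and `g ↑ a`, of orders `a` and `b`. Neither order divides the other, and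
  -- neither divides 2.
  split-path₄ : ∀ a b → n ≡ a * b → ¬ a ∣ b → ¬ b ∣ a → ¬ a ∣ 2 → ¬ b ∣ 2 → CoPath G 4
  split-path₄ a b n≡ab a∤b b∤a a∤2 b∤2 =
    ∥⇒path₄ (a∤b ∘ g↑∈⇒∣ n≡ab , b∤a ∘ g↑∈⇒∣ n≡ba) (a∤2 ∘ cancel a b n≡ab) (b∤2 ∘ cancel b a n≡ba)
    where
    n≡ba : n ≡ b * a
    n≡ba = trans n≡ab (*-comm a b)
    cancel : ∀ a b → n ≡ a * b → (g ↑ b) ∙ (g ↑ b) ≡ ε → a ∣ 2
    cancel a b n≡ eq = *-cancelʳ-∣ b {{proj₂ (factors≢0 a b n≡)}} (subst (_∣ 2 * b) n≡ (g↑-square b eq))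

  -- Splitting `n` as 2 times `c * d` would produce an involution. The pair used instead is `g ↑ d`
  -- and `g ↑ 2`, of orders 2c and cd.
  double-composite-path₄ : ∀ c d → n ≡ 2 * (c * d) → ¬ 2 ∣ d → ¬ c ∣ 1 → ¬ d ∣ 2 → CoPath G 4
  double-composite-path₄ c d n≡ 2∤d c∤1 d∤2 = ∥⇒path₄ (z∉ , w∉) zz ww
    where
    b = c * d
    instance
      b≢0 : NonZero b
      b≢0 = proj₂ (factors≢0 2 b n≡)
      c≢0 : NonZero c
      c≢0 = m*n≢0⇒m≢0 c
      d≢0 : NonZero d
      d≢0 = m*n≢0⇒n≢0 c
    vanish : ∀ {k} → 2 * b ∣ k → g ↑ k ≡ ε
    vanish {k} h = ↑-∣ g g↑n≡ε (subst (_∣ k) (sym n≡) h)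
    reflect : ∀ {k} → g ↑ k ≡ ε → 2 * b ∣ k
    reflect {k} eq = subst (_∣ k) n≡ (↑≡ε⇒∣ eq)
    eq₁ : ∀ c d → d * (2 * c) ≡ 2 * (c * d)
    eq₁ = solve-∀
    z∉ : ¬ g ↑ d ∈⟨ g ↑ 2 ⟩
    z∉ h = 2∤d (*-cancelʳ-∣ b (reflect (trans (↑-*′ g d b)
      (∈-exponent h b (trans (sym (↑-*′ g 2 b)) (vanish ∣-refl))))))
    w∉ : ¬ g ↑ 2 ∈⟨ g ↑ d ⟩
    w∉ h = d∤2 (*-cancelˡ-∣ c (subst (c * d ∣_) (*-comm 2 c) (*-cancelˡ-∣ 2 (reflect (trans (↑-*′ g 2 (2 * c))
      (∈-exponent h (2 * c) (trans (sym (↑-*′ g d (2 * c))) (vanish (∣-reflexive (sym (eq₁ c d)))))))))))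
    zz : (g ↑ d) ∙ (g ↑ d) ≢ ε
    zz eq = c∤1 (*-cancelʳ-∣ d (subst (c * d ∣_) (sym (*-identityˡ d))
      (*-cancelˡ-∣ 2 (subst (_∣ 2 * d) n≡ (g↑-square d eq)))))
    ww : (g ↑ 2) ∙ (g ↑ 2) ≢ ε
    ww eq = d∤2 (∣-trans (n∣m*n c) (*-cancelˡ-∣ 2 (subst (_∣ 2 * 2) n≡ (g↑-square 2 eq))))

  module _ {q} (pq : Prime q) (2∤q : ¬ 2 ∣ q) (n≡2q : n ≡ 2 * q) where

    private
      instance
        q≢0 : NonZero q
        q≢0 = prime⇒nonZero pq

      q∤2 : ¬ q ∣ 2
      q∤2 h with irreducible[2] h
      ... | inj₁ refl = ¬prime[1] pq
      ... | inj₂ refl = 2∤q ∣-refl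

      g↑2q : g ↑ (2 * q) ≡ ε
      g↑2q = subst (λ m → g ↑ m ≡ ε) n≡2q g↑n≡ε

    -- The involution `g ↑ q` sits between `g ↑ 2` and its inverse.
    double-prime-path₃ : CoPath G 3
    double-prime-path₃ = path₃ x∥t (∥-⁻¹ (∥-sym x∥t)) (≢-⁻¹ xx)
      where
      x∥t : g ↑ 2 ∥ g ↑ q
      x∥t = q∤2 ∘ g↑∈⇒∣ (trans n≡2q (*-comm 2 q)) , 2∤q ∘ g↑∈⇒∣ n≡2q
      xx : (g ↑ 2) ∙ (g ↑ 2) ≢ ε
      xx eq = q∤2 (*-cancelˡ-∣ 2 (subst (_∣ 2 * 2) n≡2q (g↑-square 2 eq)))

    private
      multiple-of-q : ∀ {i} → q ∣ i → g ↑ i ≡ ε ⊎ g ↑ i ≡ g ↑ q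
      multiple-of-q (divides c refl) with even⊎odd c
      ... | inj₁ (e , refl) = inj₁ (trans (cong (g ↑_) (*-assoc e 2 q)) (↑-multiple g g↑2q e))
      ... | inj₂ (e , refl) = inj₂ (trans (↑-+ g q (e * 2 * q))
        (trans (cong ((g ↑ q) ∙_) (trans (cong (g ↑_) (*-assoc e 2 q)) (↑-multiple g g↑2q e))) (identityʳ _)))

      coprime-q : ∀ {i} → ¬ q ∣ i → Coprime i q
      coprime-q q∤i (d∣i , d∣q) with prime⇒irreducible pq d∣q
      ... | inj₁ d≡1  = d≡1
      ... | inj₂ refl = contradiction d∣i q∤i

      coprime-power : ∀ h {i m} → h ↑ m ≡ ε → Coprime i m → h ∈⟨ h ↑ i ⟩
      coprime-power h {i} {m} h↑m cop with coprime-Bézout cop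
      ... | Bézout.+- x y eq = x , (begin
        h                       ≡⟨ identityʳ h ⟨
        h ∙ ε                   ≡⟨ cong (h ∙_) (↑-multiple h h↑m y) ⟨
        h ↑ (1 + y * m)         ≡⟨ cong (h ↑_) eq ⟩
        h ↑ (x * i)             ≡⟨ ↑-* h x i ⟩
        (h ↑ i) ↑ x             ∎)
        where open ≡-Reasoning
      -- The coefficient of `i` is negative here: `h ∙ h ↑ (x * i)` is trivial, so `h` is the
      -- inverse of a power of `h ↑ i`.
      ... | Bézout.-+ x y eq = subst (_∈⟨ h ↑ i ⟩)
        (sym (inverseˡ-unique h (h ↑ (x * i)) (trans (cong (h ↑_) eq) (↑-multiple h h↑m y))))
        (∈-trans ∈-⁻¹ (x , ↑-* h x i))

      -- The element `g ↑ 2` is killed by `q`, and `i` is coprime to `q`. So it is a power of its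
      -- own `i`-th power, which is the square of `g ↑ i`.
      square-∈ : ∀ {i} → ¬ q ∣ i → g ↑ 2 ∈⟨ g ↑ i ⟩
      square-∈ {i} q∤i = ∈-trans (coprime-power (g ↑ 2) (trans (sym (↑-*′ g 2 q)) g↑2q) (coprime-q q∤i))
        (2 , trans (sym (↑-*′ g 2 i)) (↑-* g 2 i))

      even-∈ : ∀ {i} c → ¬ q ∣ i → g ↑ (c * 2) ∈⟨ g ↑ i ⟩
      even-∈ c q∤i = ∈-trans (c , ↑-* g c 2) (square-∈ q∤i)

      odd-generates : ∀ c → ¬ q ∣ 1 + c * 2 → g ∈⟨ g ↑ (1 + c * 2) ⟩
      odd-generates c q∤ = subst (_∈⟨ g ↑ (1 + c * 2) ⟩) (//-rightDividesʳ (g ↑ (c * 2)) g)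
        (∈-∙ ∈-refl (∈-trans ∈-⁻¹ (even-∈ c q∤)))

    -- An exponent divisible by `q` gives `ε` or the excluded involution. Among the others, odd
    -- exponents give generators, and even powers of `g` are powers of each remaining element.
    all-but-involution-adjacent : ∀ u v → u ≢ g ↑ q → v ≢ g ↑ q → u ≢ v → Adj G u v
    all-but-involution-adjacent u v u≢t v≢t u≢v with gen u | gen v
    ... | i , refl | j , refl = u≢v , related
      where
      related : g ↑ j ∈⟨ g ↑ i ⟩ ⊎ g ↑ i ∈⟨ g ↑ j ⟩
      related with q ∣? i | q ∣? j
      ... | yes q∣i | _ = [ (λ eq → inj₂ (0 , eq)) , (λ eq → contradiction eq u≢t) ]′ (multiple-of-q q∣i)
      ... | no _ | yes q∣j = [ (λ eq → inj₁ (0 , eq)) , (λ eq → contradiction eq v≢t) ]′ (multiple-of-q q∣j)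
      ... | no q∤i | no q∤j with even⊎odd i | even⊎odd j
      ...   | _ | inj₁ (c , refl) = inj₁ (even-∈ c q∤i)
      ...   | inj₁ (c , refl) | inj₂ _ = inj₂ (even-∈ c q∤j)
      ...   | inj₂ (c , refl) | inj₂ _ = inj₁ (∈-trans (j , refl) (odd-generates c q∤i))

-- Prime divisors and cyclic groups whose order is not a prime power

prime-divisor : ∀ n → 2 ≤ n → ∃[ p ] (Prime p × p ∣ n)
prime-divisor = <-rec _ λ n rec 2≤n → step n rec 2≤n
  where
  step : ∀ n → (∀ {m} → m < n → 2 ≤ m → ∃[ p ] (Prime p × p ∣ m)) → 2 ≤ n → ∃[ p ] (Prime p × p ∣ n)
  step n rec 2≤n with prime? n
  ... | yes pn = n , pn , ∣-refl
  ... | no ¬pn with ¬prime⇒composite {{n>1⇒nonTrivial 2≤n}} ¬pn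
  ...   | composite {d} d<n d∣n with rec d<n (nonTrivial⇒n>1 d)
  ...     | p , pp , p∣d = p , pp , ∣-trans p∣d d∣n

-- Preferring p ≡ 2 makes the cofactor of the p-part of n different from 2.
prime-divisor-2 : ∀ n → 2 ≤ n → ∃[ p ] (Prime p × p ∣ n × (2 ∣ n → p ≡ 2))
prime-divisor-2 n 2≤n with 2 ∣? n
... | yes 2∣n = 2 , prime[2] , 2∣n , λ _ → refl
... | no  2∤n with prime-divisor n 2≤n
...   | p , pp , p∣n = p , pp , p∣n , λ 2∣n → contradiction 2∣n 2∤n

p-part : ∀ p → 2 ≤ p → ∀ n → .{{NonZero n}} → ∃[ k ] ∃[ m ] (n ≡ p ^ k * m × ¬ p ∣ m)
p-part p 2≤p = <-rec _ step
  where
  step : ∀ n → (∀ {m} → m < n → .{{NonZero m}} → ∃[ k ] ∃[ l ] (m ≡ p ^ k * l × ¬ p ∣ l)) →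
         .{{NonZero n}} → ∃[ k ] ∃[ m ] (n ≡ p ^ k * m × ¬ p ∣ m)
  step n rec with p ∣? n
  ... | no p∤n = 0 , n , sym (+-identityʳ n) , p∤n
  ... | yes (divides q refl) with rec {q} (m<m*n q p {{m*n≢0⇒m≢0 q}} 2≤p) {{m*n≢0⇒m≢0 q}}
  ...   | k , m , eq , p∤m = suc k , m , trans (cong (_* p) eq) (rearrange p (p ^ k) m) , p∤m
    where
    rearrange : ∀ p a m → a * m * p ≡ p * a * m
    rearrange = solve-∀

prime∣^⇒∣ : ∀ {r} p k → Prime r → r ∣ p ^ k → r ∣ p
prime∣^⇒∣ p zero    pr h = contradiction (subst Prime (∣1⇒≡1 h) pr) ¬prime[1]
prime∣^⇒∣ p (suc k) pr h with euclidsLemma p (p ^ k) pr h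
... | inj₁ r∣p = r∣p
... | inj₂ r∣  = prime∣^⇒∣ p k pr r∣

-- Split `n` into its `p`-part `a` and a cofactor `b` prime to `p`, where `b` is not 1. The elements
-- of orders `a` and `b` give a path unless `a` is 2. In that case `b` is odd, and it is either
-- prime or composite.
cyclic-dichotomy : ∀ {n} (G : FinGroup n) → 2 ≤ n → IsCyclic G → ¬ IsPrimePower n →
  CoPath G 4 ⊎ ∃[ q ] (Prime q × ¬ (2 ∣ q) × n ≡ 2 * q)
cyclic-dichotomy {n} G 2≤n (g , gen) ¬pp
  with p , pp , p∣n , 2∣n⇒p≡2 ← prime-divisor-2 n 2≤n
  with k , b , n≡ , p∤b ← p-part p (nonTrivial⇒n>1 p {{prime⇒nonTrivial pp}}) n {{>-nonZero (<-trans z<s 2≤n)}}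
  = go
  where
  open Cyclic G g gen

  a = p ^ k

  b≢1 : b ≢ 1
  b≢1 refl = ¬pp (p , k , pp , trans n≡ (*-identityʳ a))

  b≢0 : b ≢ 0
  b≢0 refl = p∤b (p ∣0)

  2≤b : 2 ≤ b
  2≤b = ≤∧≢⇒< (n≢0⇒n>0 b≢0) (b≢1 ∘ sym)

  ^∤b : ∀ k → n ≡ p ^ k * b → ¬ p ^ k ∣ b
  -- Exponent 0 would give `n ≡ b`, although `p` divides `n` and not `b`.
  ^∤b zero    eq _ = p∤b (subst (p ∣_) (trans eq (+-identityʳ b)) p∣n)
  ^∤b (suc k) _  h = p∤b (∣-trans (m∣m*n (p ^ k)) h)

  a∤b : ¬ a ∣ b
  a∤b = ^∤b k n≡

  b∤a : ¬ b ∣ a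
  b∤a h with prime-divisor b 2≤b
  ... | r , pr , r∣b with prime⇒irreducible pp (prime∣^⇒∣ p k pr (∣-trans r∣b h))
  ...   | inj₁ refl = ¬prime[1] pr
  ...   | inj₂ refl = p∤b r∣b

  b∤2 : ¬ b ∣ 2
  b∤2 h with irreducible[2] h
  ... | inj₁ b≡1 = b≢1 b≡1
  ... | inj₂ b≡2 = p∤b (∣-reflexive (trans (2∣n⇒p≡2 2∣n) (sym b≡2)))
    where
    2∣n : 2 ∣ n
    2∣n = subst₂ (λ c m → c ∣ m) b≡2 (sym n≡) (n∣m*n a)

  n≡2b : a ≡ 2 → n ≡ 2 * b
  n≡2b a≡2 = trans n≡ (cong (_* b) a≡2)

  2∤b : a ≡ 2 → ¬ 2 ∣ b
  2∤b a≡2 h = p∤b (subst (_∣ b) (sym (2∣n⇒p≡2 (subst (2 ∣_) (sym (n≡2b a≡2)) (m∣m*n b)))) h)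

  go : CoPath G 4 ⊎ ∃[ q ] (Prime q × ¬ (2 ∣ q) × n ≡ 2 * q)
  go with a ∣? 2
  ... | no a∤2 = inj₁ (split-path₄ a b n≡ a∤b b∤a a∤2 b∤2)
  ... | yes a∣2 with irreducible[2] a∣2
  ...   | inj₁ a≡1 = contradiction (subst (_∣ b) (sym a≡1) (1∣ b)) a∤b
  ...   | inj₂ a≡2 with prime? b
  ...     | yes pb = inj₂ (b , pb , 2∤b a≡2 , n≡2b a≡2)
  ...     | no ¬pb with ¬prime⇒composite {{n>1⇒nonTrivial 2≤b}} ¬pb
  -- A proper divisor `d` of `b` has a cofactor `c` other than 1. It does not divide 2, being odd
  -- and larger than 1.
  ...       | composite {d} d<b d∣b@(divides c b≡cd) =
    inj₁ (double-composite-path₄ c d (trans (n≡2b a≡2) (cong (2 *_) b≡cd)) 2∤d c∤1 d∤2)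
    where
    2∤d : ¬ 2 ∣ d
    2∤d h = 2∤b a≡2 (∣-trans h d∣b)
    c∤1 : ¬ c ∣ 1
    c∤1 h with refl ← ∣1⇒≡1 h = <⇒≢ d<b (sym (trans b≡cd (+-identityʳ d)))
    d∤2 : ¬ d ∣ 2
    d∤2 h with irreducible[2] h
    ... | inj₁ d≡1 = nonTrivial⇒≢1 {d} d≡1
    ... | inj₂ d≡2 = 2∤d (∣-reflexive (sym d≡2))

-- Lower bounds and the classification

three-in-two : ∀ {m a b c} → a ≢ b → a ≢ c → b ≢ c →
  m ≤ a → m ≤ b → m ≤ c → a ≤ suc m → b ≤ suc m → ¬ c ≤ suc m
three-in-two {m} {a} {b} {c} a≢b a≢c b≢c ma mb mc am bm cm with val ma am | val mb bm | val mc cm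
  where
  val : ∀ {a} → m ≤ a → a ≤ suc m → a ≡ m ⊎ a ≡ suc m
  val {a} ma am with m≤n⇒m<n∨m≡n ma
  ... | inj₁ m<a = inj₂ (≤-antisym am m<a)
  ... | inj₂ m≡a = inj₁ (sym m≡a)
... | inj₁ refl | inj₁ refl | _         = a≢b refl
... | inj₁ refl | inj₂ refl | inj₁ refl = a≢c refl
... | inj₁ refl | inj₂ refl | inj₂ refl = b≢c refl
... | inj₂ refl | inj₂ refl | _         = a≢b refl
... | inj₂ refl | inj₁ refl | inj₁ refl = b≢c refl
... | inj₂ refl | inj₁ refl | inj₂ refl = a≢c refl

module _ {n : ℕ} (G : FinGroup n) where
  open FinGroup G
  open PowerGraph G

  -- Every other label is at least 2 away from that of `ε`. If the span were at most 3, the three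
  -- labels would lie on one side of it, at distance 2 or 3, which leaves two values for three
  -- distinct labels.
  four-vertices⇒span : ∀ {a b c} → a ≢ ε → b ≢ ε → c ≢ ε → a ≢ b → a ≢ c → b ≢ c →
    ∀ f → IsL21 G f → 4 ≤ span G f
  four-vertices⇒span {a} {b} {c} a≢ε b≢ε c≢ε a≢b a≢c b≢c f L@(apart , _)
    with 4 ≤? span G f
  ... | yes 4≤ = 4≤
  ... | no  4≰ = ⊥-elim (sides (ε-apart a≢ε) (ε-apart b≢ε) (ε-apart c≢ε))
    where
    ε-apart : ∀ {x} → x ≢ ε → Apart (f ε) (f x)
    ε-apart {x} x≢ε = apart ε x (x≢ε ∘ sym , inj₂ ∈-ε)

    near : ∀ u v → f v ≤ 3 + f u
    near u v = ≤-trans (spread≤span G f u v) (+-monoˡ-≤ (f u) (≤-pred (≰⇒> 4≰)))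

    opposite : ∀ x y → 2 + f ε ≤ f x → ¬ 2 + f y ≤ f ε
    opposite x y hi lo = 1+n≰n (≤-trans (+-monoʳ-≤ 2 lo) (≤-trans hi (near y x)))

    distinct : ∀ {x y} → x ≢ y → f x ≢ f y
    distinct = L21-injective f L _ _

    sides : Apart (f ε) (f a) → Apart (f ε) (f b) → Apart (f ε) (f c) → ⊥
    sides (inj₁ ha) (inj₁ hb) (inj₁ hc) =
      three-in-two (distinct a≢b) (distinct a≢c) (distinct b≢c) ha hb hc (near ε a) (near ε b) (near ε c)
    -- Below `f ε` all three labels are raised by 3, so that they land in `f ε` and `suc (f ε)`
    -- without subtraction.
    sides (inj₂ la) (inj₂ lb) (inj₂ lc) =
      three-in-two (shifted a≢b) (shifted a≢c) (shifted b≢c) (near a ε) (near b ε) (near c ε) (s≤s la) (s≤s lb) (s≤s lc)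
      where
      shifted : ∀ {x y} → x ≢ y → 3 + f x ≢ 3 + f y
      shifted x≢y = distinct x≢y ∘ +-cancelˡ-≡ 3 _ _
    sides (inj₁ h) (inj₂ l) _ = opposite a b h l
    sides (inj₁ h) _ (inj₂ l) = opposite a c h l
    sides (inj₂ l) (inj₁ h) _ = opposite b a h l
    sides (inj₂ l) _ (inj₁ h) = opposite c a h l

klein-square : ∀ x → klein x x ≡ (zero , zero)
klein-square (zero     , zero)     = refl
klein-square (zero     , suc zero) = refl
klein-square (suc zero , zero)     = refl
klein-square (suc zero , suc zero) = refl

-- The order is 4, so the bound is 4, and the three elements other than `ε` feed
-- `four-vertices⇒span`.
klein⇒span : ∀ {n} (G : FinGroup n) → IsoTo G (Fin 2 × Fin 2) klein →
  ∀ f → IsL21 G f → 2 * n ∸ 4 ≤ span G f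
klein⇒span {n} G (φ , ψ , ψφ , φψ , hom) f L =
  subst (λ m → 2 * m ∸ 4 ≤ span G f) (sym n≡4)
    (four-vertices⇒span G {ψ (suc zero , zero)} {ψ (zero , suc zero)} {ψ (suc zero , suc zero)}
      (≢ε λ ()) (≢ε λ ()) (≢ε λ ()) (ψ-≢ λ ()) (ψ-≢ λ ()) (ψ-≢ λ ()) f L)
  where
  open FinGroup G
  n≡4 : n ≡ 4
  n≡4 = ↔⇒≡ (↔-trans (mk↔ₛ′ φ ψ φψ ψφ) (↔-sym (Fin.*↔× {2} {2})))
  φε : φ ε ≡ (zero , zero)
  φε = trans (cong φ (sym (IsGroup.identityˡ isGroup ε))) (trans (hom ε ε) (klein-square (φ ε)))
  ≢ε : ∀ {a} → a ≢ (zero , zero) → ψ a ≢ ε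
  ≢ε {a} a≢0 eq = a≢0 (trans (sym (φψ a)) (trans (cong φ eq) φε))
  ψ-≢ : ∀ {a b} → a ≢ b → ψ a ≢ ψ b
  ψ-≢ {a} {b} a≢b eq = a≢b (trans (sym (φψ a)) (trans (cong φ eq) (φψ b)))

iso-zadd⇒cyclic : ∀ {n} (G : FinGroup n) {m} → 2 ≤ m → IsoTo G (Fin m) zadd → IsCyclic G
iso-zadd⇒cyclic {n} G {m} 2≤m (φ , ψ , ψφ , φψ , hom) =
  g , λ x → toℕ (φ x) , trans (sym (ψφ x)) (trans (cong ψ (sym (fromℕ<-toℕ (φ x) (toℕ<n (φ x))))) (ψ-pow _ (toℕ<n (φ x))))
  where
  open FinGroup G
  open GroupProperties (PowerGraph.group G)
  instance
    m≢0 : NonZero m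
    m≢0 = >-nonZero (<-trans z<s 2≤m)
  g : Fin n
  -- The generator is the image of the residue 1, which exists because 2 ≤ m. All sums formed below
  -- stay under `m`, so no reduction occurs.
  g = ψ (fromℕ< 2≤m)
  ψ-hom : ∀ a b → ψ (zadd a b) ≡ ψ a ∙ ψ b
  ψ-hom a b = trans (cong ψ (sym (trans (hom (ψ a) (ψ b)) (cong₂ zadd (φψ a) (φψ b))))) (ψφ _)
  add : ∀ i j (i<m : i < m) (j<m : j < m) (ij<m : i + j < m) →
    zadd (fromℕ< i<m) (fromℕ< j<m) ≡ fromℕ< ij<m
  add i j i<m j<m ij<m = toℕ-injective (begin
    toℕ (zadd (fromℕ< i<m) (fromℕ< j<m))             ≡⟨ toℕ-zadd (fromℕ< i<m) (fromℕ< j<m) ⟩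
    (toℕ (fromℕ< i<m) + toℕ (fromℕ< j<m)) % m        ≡⟨ cong₂ (λ a b → (a + b) % m) (toℕ-fromℕ< i<m) (toℕ-fromℕ< j<m) ⟩
    (i + j) % m                                      ≡⟨ m<n⇒m%n≡m ij<m ⟩
    i + j                                            ≡⟨ toℕ-fromℕ< ij<m ⟨
    toℕ (fromℕ< ij<m)                                ∎)
    where open ≡-Reasoning
  ψ-pow : ∀ k (k<m : k < m) → ψ (fromℕ< k<m) ≡ pow G g k
  -- The image of the residue 0 is idempotent, hence the identity.
  ψ-pow zero    0<m = identityʳ-unique (ψ z) (ψ z) (trans (sym (ψ-hom z z)) (cong ψ (add 0 0 0<m 0<m 0<m)))
    where z = fromℕ< 0<m
  ψ-pow (suc k) k<m = begin
    ψ (fromℕ< k<m)                        ≡⟨ cong ψ (add 1 k 2≤m k<m′ k<m) ⟨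
    ψ (zadd (fromℕ< 2≤m) (fromℕ< k<m′))   ≡⟨ ψ-hom _ _ ⟩
    g ∙ ψ (fromℕ< k<m′)                   ≡⟨ cong (g ∙_) (ψ-pow k k<m′) ⟩
    g ∙ pow G g k                         ∎
    where
    open ≡-Reasoning
    k<m′ : k < m
    k<m′ = <-trans (n<1+n k) k<m

double-prime⇒span : ∀ {n} (G : FinGroup n) {q} → Prime q → ¬ 2 ∣ q → IsoTo G (Fin (2 * q)) zadd →
  ∀ f → IsL21 G f → 2 * n ∸ 4 ≤ span G f
double-prime⇒span {n} G {q} pq 2∤q iso@(φ , ψ , ψφ , φψ , _)
  with g , gen ← iso-zadd⇒cyclic G (m≤m*n 2 q {{prime⇒nonZero pq}}) iso =
  almost-complete⇒span G (pow G g q)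
    (Cyclic.all-but-involution-adjacent G g gen pq 2∤q (↔⇒≡ (mk↔ₛ′ φ ψ φψ ψφ)))

-- Extremal groups and the case of equality

Extremal : ∀ {n} → FinGroup n → Set
Extremal G = IsoTo G (Fin 2 × Fin 2) klein ⊎ ∃[ q ] (Prime q × ¬ (2 ∣ q) × IsoTo G (Fin (2 * q)) zadd)

extremal⇒span : ∀ {n} (G : FinGroup n) → Extremal G → ∀ f → IsL21 G f → 2 * n ∸ 4 ≤ span G f
extremal⇒span G (inj₁ iso)                   = klein⇒span G iso
extremal⇒span G (inj₂ (q , pq , 2∤q , iso)) = double-prime⇒span G pq 2∤q iso

path₄-or-extremal : ∀ {n} (G : FinGroup n) → 2 ≤ n → ¬ (IsCyclic G × IsPrimePower n) →
  CoPath G 4 ⊎ (CoPath G 3 × Extremal G)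
path₄-or-extremal G 2≤n ¬cpp with PowerGraph.path₄-or-klein-or-cyclic G
... | inj₁ P                = inj₁ P
... | inj₂ (inj₁ (P , iso)) = inj₂ (P , inj₁ iso)
... | inj₂ (inj₂ cyc@(g , gen)) with cyclic-dichotomy G 2≤n cyc (λ pp → ¬cpp (cyc , pp))
...   | inj₁ P                        = inj₁ P
...   | inj₂ (q , pq , 2∤q , n≡2q) =
  inj₂ (double-prime-path₃ pq 2∤q n≡2q ,
        inj₂ (q , pq , 2∤q , subst (λ m → IsoTo G (Fin m) zadd) n≡2q iso-zadd))
  where open Cyclic G g gen

path₄⇒¬λ≡2n∸4 : ∀ {n} (G : FinGroup n) → CoPath G 4 → ¬ LambdaIs G (2 * n ∸ 4)
path₄⇒¬λ≡2n∸4 {n} G P (_ , least) =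
  <⇒≱ (≤-<-trans span-label (∸-monoʳ-< {2 * n} {5} {4} ≤-refl 5≤2n)) (least label label-L21)
  where
  open PathLabeling G P
  -- Strictness of truncated subtraction needs this bound. The four distinct path vertices force n ≥
  -- 4.
  5≤2n : 5 ≤ 2 * n
  5≤2n = ≤-trans (m≤m+n 5 3) (*-monoʳ-≤ 2 (injective⇒≤ (CoPath.injective P)))

theorem4p1 : (n : ℕ) (G : FinGroup n) → 2 ≤ n → ¬ (IsCyclic G × IsPrimePower n)
    → (∃[ f ] (IsL21 G f × span G f ≤ 2 * n ∸ 4))
    × (LambdaIs G (2 * n ∸ 4)
    ⇔ (IsoTo G (Fin 2 × Fin 2) klein
    ⊎ ∃[ q ] (Prime q × ¬ (2 ∣ q) × IsoTo G (Fin (2 * q)) zadd)))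
theorem4p1 n G 2≤n ¬cpp = upper , mk⇔ to from
  where
  classification : CoPath G 4 ⊎ (CoPath G 3 × Extremal G)
  classification = path₄-or-extremal G 2≤n ¬cpp

  upper : ∃[ f ] (IsL21 G f × span G f ≤ 2 * n ∸ 4)
  upper with classification
  ... | inj₁ P       = label , label-L21 , ≤-trans span-label (∸-monoʳ-≤ (2 * n) (n≤1+n 4))
    where open PathLabeling G P
  ... | inj₂ (P , _) = label , label-L21 , span-label
    where open PathLabeling G P

  to : LambdaIs G (2 * n ∸ 4) → Extremal G
  to lam with classification
  ... | inj₁ P       = contradiction lam (path₄⇒¬λ≡2n∸4 G P)
  ... | inj₂ (_ , e) = e

  from : Extremal G → LambdaIs G (2 * n ∸ 4)
  -- The lower bound holds for every labeling, so the one from `upper` attains it.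
  from e with f , L , f≤ ← upper = (f , L , ≤-antisym f≤ (extremal⇒span G e f L)) , extremal⇒span G e
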